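{- Every linear DeBruijn sequence is a double helix.
   Context: All strings are over the alphabet $\{0,1\}$, identified with the field $\mathbb{Z}_2$. A DeBruijn string of order $n$ is a binary string of minimal length (namely $2^n+n-1$) that contains every binary string of length $n$ as a (contiguous) substring. A DeBruijn cycle of order $n$ is a cyclic binary string of length $2^n$ in which every binary string of length $n$ occurs (cyclically); reading it once around from any starting point and then appending the first $n-1$ digits read yields an associated DeBruijn string of order $n$. Linear DeBruijn sequences: consider a linear recurrence $a_k = c_1a_{k-1}+c_2a_{k-2}+\dots+c_na_{k-n}$, $k=0,1,\dots$, over $\mathbb{Z}_2$, with coefficients $c_i\in\mathbb{Z}_2$ and given initial values $a_{ -1},\dots,a_{ -n}$. A binary sequence so produced is called a PN sequence (of order $n$) if it has the maximal possible period $2^n-1$. A full period of a PN sequence, viewed cyclically, contains every binary string of length $n$ except the all-zero one; inserting an extra $0$ at the beginning of the unique string of $n-1$ zeros in this cycle yields a DeBruijn cycle of order $n$. The cycles obtained in this way are called linear DeBruijn cycles, and their associated DeBruijn strings are called linear DeBruijn sequences. The DeBruijn graph $\mathcal{B}^n$ is the directed graph whose vertices are the binary strings of length $n$, with an edge from $x\rho$ (with $x$ a digit, $|\rho|=n-1$) to each of $\rho0$ and $\rho1$, and no other edges. A DeBruijn string $X$ of order $n$ begins and ends with the same string of length $n-1$, so the path visiting in order its successive substrings of length $n$ closes up, by the edge from its last vertex to its first, to a Hamiltonian circuit of $\mathcal{B}^n$. $X$ is called a double helix if the graph obtained from $\mathcal{B}^n$ by removing the edges of this circuit has exactly 3 connected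 components (described as the minimum number possible), including the loop from the all-zero string of length $n$ to itself and the loop from the all-one string of length $n$ to itself. A DeBruijn cycle is also called a double helix if the associated DeBruijn string is a double helix.
   Formalization: The order n is assumed to be at least 2; for n = 1 the claim fails, since removing the circuit 0→1→0 of the linear DeBruijn cycle 01 from the DeBruijn graph leaves only two components (the two loops), not three. -}

module Defs where

open import Data.Fin.Base using (Fin; toℕ)
open import Data.List.Base
  using (List; _∷_; _++_; length; take; drop; replicate; applyUpTo)
open import Data.Nat.Base using (ℕ; suc; _+_; _∸_; _^_; _≤_; _<_)
open import Data.Parity.Base as ℙ using (Parity; 0ℙ; 1ℙ)
open import Data.Parity.Properties using (+-0-commutativeMonoid)
open import Data.Product.Base using (∃; ∃₂; _×_)
open import Data.Sum.Base using (_⊎_)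
open import Data.Vec.Base as Vec using (Vec; toList)
open import Function.Bundles using (Bijection)
open import Level using (0ℓ)
open import Relation.Binary.Construct.Closure.Equivalence as Eq using (EqClosure)
open import Relation.Binary.Core using (Rel)
open import Relation.Binary.PropositionalEquality.Core using (_≡_)
import Relation.Binary.PropositionalEquality.Properties as ≡
open import Relation.Nullary.Negation.Core using (¬_)
open import Algebra.Properties.CommutativeMonoid.Sum +-0-commutativeMonoid using (sum)

-- Parity, with its addition and multiplication, is the field ℤ₂ of digits.

-- The length of  toList u  is n, so this also forces i + n ≤ length X (for n > 0).
OccursAt : ∀ {n} → List Parity → ℕ → Vec Parity n → Set
OccursAt {n} X i u = take n (drop i X) ≡ toList u

ContainsAll : ℕ → List Parity → Set
ContainsAll n X = (u : Vec Parity n) → ∃ λ i → OccursAt X i u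

record DeBruijnString (n : ℕ) (X : List Parity) : Set where
  field
    containsAll : ContainsAll n X
    minimal     : ∀ Y → ContainsAll n Y → length X ≤ length Y

-- A cyclic string is represented by any of its readings once around; two
-- lists represent the same cyclic string when they are related by Rotation.
Rotation : Rel (List Parity) 0ℓ
Rotation U V = ∃₂ λ P Q → U ≡ P ++ Q × V ≡ Q ++ P

-- Indices are shifted by n with respect to the usual convention: the initial
-- values a₋ₙ , … , a₋₁ are  a 0 , … , a (n ∸ 1),  and  c i  is c_{i+1}.
Recurrence : (n : ℕ) → (Fin n → Parity) → (ℕ → Parity) → Set
Recurrence n c a = ∀ k → a (k + n) ≡ sum (λ i → c i ℙ.* a ((k + n) ∸ suc (toℕ i)))

IsPeriod : (ℕ → Parity) → ℕ → Set
IsPeriod a p = 0 < p × (∀ k → a (k + p) ≡ a k)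

LeastPeriod : (ℕ → Parity) → ℕ → Set
LeastPeriod a p = IsPeriod a p × (∀ q → IsPeriod a q → p ≤ q)

record PNSequence (n : ℕ) (a : ℕ → Parity) : Set where
  field
    coefficients : Fin n → Parity
    recurrence   : Recurrence n coefficients a
    period       : LeastPeriod a (2 ^ n ∸ 1)

-- W reads a full period of a PN sequence cyclically, starting at the run of
-- n − 1 zeros; the extra 0 is inserted in front of that run.
record LinearDeBruijnCycle (n : ℕ) (Z : List Parity) : Set where
  field
    a        : ℕ → Parity
    isPN     : PNSequence n a
    W        : List Parity
    rotation : Rotation (applyUpTo a (2 ^ n ∸ 1)) W
    zeros    : take (n ∸ 1) W ≡ replicate (n ∸ 1) 0ℙ
    inserted : Z ≡ 0ℙ ∷ W

AssociatedString : ℕ → List Parity → List Parity → Set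
AssociatedString n Z X = ∃ λ Y → Rotation Z Y × X ≡ Y ++ take (n ∸ 1) Y

LinearDeBruijnSequence : ℕ → List Parity → Set
LinearDeBruijnSequence n X = ∃ λ Z → LinearDeBruijnCycle n Z × AssociatedString n Z X

data DeBruijnEdge : ∀ {n} → Vec Parity n → Vec Parity n → Set where
  edge : ∀ {m} (x : Parity) (ρ : Vec Parity m) (y : Parity) →
         DeBruijnEdge (x Vec.∷ ρ) (ρ Vec.∷ʳ y)

-- The steps between successive length-n substrings of X, together with the
-- closing step from the last of them (at position length X ∸ n) to the first.
CircuitEdge : (n : ℕ) → List Parity → Rel (Vec Parity n) 0ℓ
CircuitEdge n X u v =
  (∃ λ i → OccursAt X i u × OccursAt X (suc i) v)
  ⊎ (OccursAt X (length X ∸ n) u × OccursAt X 0 v)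

RemainingEdge : (n : ℕ) → List Parity → Rel (Vec Parity n) 0ℓ
RemainingEdge n X u v = DeBruijnEdge u v × ¬ CircuitEdge n X u v

-- EqClosure E is connectedness in the digraph E, ignoring directions, so the
-- setoid below is the set of connected components.
ComponentCount : {V : Set} → Rel V 0ℓ → ℕ → Set
ComponentCount E k = Bijection (Eq.setoid E) (≡.setoid (Fin k))

-- {v} is a connected component, and it carries the loop at v.
LoopComponent : {V : Set} → Rel V 0ℓ → V → Set
LoopComponent E v = E v v × (∀ w → EqClosure E v w → w ≡ v)

record DoubleHelix (n : ℕ) (X : List Parity) : Set where
  field
    deBruijn        : DeBruijnString n X
    threeComponents : ComponentCount (RemainingEdge n X) 3
    loopAtZeros     : LoopComponent (RemainingEdge n X) (Vec.replicate n 0ℙ)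
    loopAtOnes      : LoopComponent (RemainingEdge n X) (Vec.replicate n 1ℙ)

{-# OPTIONS --safe #-}
module Submission where

-- Let L be the linear feedback function of the PN sequence. Its shift register
-- has two orbits, 0…0 and all other words; in particular L(10…0) = 1 and
-- L(1…1) = 0. The De Bruijn circuit follows L, except that 10…0 → 0…01 is
-- rerouted through 0…0, so each vertex keeps exactly one outgoing edge, the one
-- to the other successor. Complementing all digits conjugates the feedback 1 + L
-- to L, since L(v + 1…1) = L(v) + L(1…1); hence the register of 1 + L has the two
-- orbits 1…1 and all other words. The remaining edges arise from it by cutting
-- 0…0 out of the long orbit, which leaves the loops at 0…0 and 1…1 and one
-- component on all other words.

open import Defs
open import Data.Fin.Base as Fin using (Fin; zero; suc; toℕ; fromℕ<; opposite; funToFin)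
open import Data.Fin.Patterns using (0F; 1F; 2F)
import Data.Fin.Properties as Fin
open import Data.List.Base using (List; []; _∷_; _++_; length; take; drop; replicate; applyUpTo)
open import Data.List.Properties
  using (∷-injective; length-take; length-drop; length-applyUpTo)
open import Data.Nat.Base using (ℕ; zero; suc; _+_; _*_; _∸_; _^_; _⊓_; _%_; _≤_; _<_;
  z≤n; s≤s; s≤s⁻¹; z<s; NonZero; >-nonZero)
open import Data.Nat.DivMod using (_/_; m≡m%n+[m/n]*n; m%n<n; m<n⇒m%n≡m; [m+n]%n≡m%n)
open import Data.Nat.Properties hiding (_≟_)
open import Data.Parity.Base as ℙ using (Parity; 0ℙ; 1ℙ; _⁻¹)
import Data.Parity.Properties as ℙ
open import Data.Product.Base using (∃; _×_; _,_; proj₁; proj₂)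
open import Data.Product.Properties using (,-injective)
open import Data.Sum.Base using (_⊎_; inj₁; inj₂)
open import Data.Vec.Base as Vec using (Vec; _∷_; _∷ʳ_; lookup; tabulate; toList)
import Data.Vec.Properties as Vec
open import Function.Base using (_∘_)
open import Function.Bundles using (_⇔_; mk⇔; Equivalence)
open import Function.Definitions using (Injective)
open import Level using (0ℓ)
open import Relation.Binary.Construct.Closure.Equivalence as Eq using (EqClosure)
open import Relation.Binary.Construct.Closure.ReflexiveTransitive using (ε; _◅_; _◅◅_)
open import Relation.Binary.Construct.Closure.Symmetric using (fwd)
open import Relation.Binary.Core using (Rel)
open import Relation.Binary.Definitions using (tri<; tri≈; tri>)
open import Relation.Binary.PropositionalEquality
open import Relation.Nullary using (¬_; Dec; yes; no; contradiction)
open import Algebra.Properties.CommutativeMonoid.Sum ℙ.+-0-commutativeMonoid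
  using (sum; sum-cong-≗; ∑-distrib-+; sum-replicate-zero)

private variable
  A : Set
  m n p : ℕ

-- Periodic sequences

Periodic : ℕ → (ℕ → A) → Set
Periodic p f = ∀ k → f (k + p) ≡ f k

periodic-* : {f : ℕ → A} → Periodic p f → ∀ t → Periodic (t * p) f
periodic-* {f = f} per zero k = cong f (+-identityʳ k)
periodic-* {p = p} {f = f} per (suc t) k = begin
  f (k + (p + t * p))  ≡⟨ cong f (trans (cong (k +_) (+-comm p (t * p))) (sym (+-assoc k (t * p) p))) ⟩
  f (k + t * p + p)    ≡⟨ per (k + t * p) ⟩
  f (k + t * p)        ≡⟨ periodic-* per t k ⟩
  f k                  ∎
  where open ≡-Reasoning

periodic-shift : {f : ℕ → A} → Periodic p f → ∀ r → Periodic p (λ k → f (r + k))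
periodic-shift {p = p} {f = f} per r k = trans (cong f (sym (+-assoc r k p))) (per (r + k))

periodic-% : .{{_ : NonZero p}} {f : ℕ → A} → Periodic p f → ∀ k → f k ≡ f (k % p)
periodic-% {p = p} {f = f} per k =
  trans (cong f (m≡m%n+[m/n]*n k p)) (periodic-* per (k / p) (k % p))

-- Adding `r` laps moves the index `i` to or past `r`: as `p` is nonzero, `r ≤ r * p`, so the
-- subtraction is not truncated.
periodic-revisit : .{{_ : NonZero p}} {f : ℕ → A} → Periodic p f →
                   ∀ r i → ∃ λ t → f (t + r) ≡ f i
periodic-revisit {p = p} {f = f} per r i = i + (r * p ∸ r) , (begin
  f (i + (r * p ∸ r) + r)    ≡⟨ cong f (+-assoc i _ r) ⟩
  f (i + (r * p ∸ r + r))    ≡⟨ cong (λ k → f (i + k)) (m∸n+n≡m (m≤m*n r p)) ⟩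
  f (i + r * p)              ≡⟨ periodic-* per r i ⟩
  f i                        ∎)
  where open ≡-Reasoning

-- Revisiting the pair returns to `f (k + d)` and `f k` with one common offset, as is needed to
-- carry a period `d` from a tail back to the whole sequence.
periodic-pair : {f : ℕ → A} → Periodic p f → ∀ d → Periodic p (λ k → f (k + d) , f k)
periodic-pair {p = p} {f = f} per d k = cong₂ _,_
  (trans (cong f (trans (+-assoc k p d) (trans (cong (k +_) (+-comm p d)) (sym (+-assoc k d p))))) (per (k + d)))
  (per k)

periodic-revisit-< : .{{_ : NonZero p}} {f : ℕ → A} → Periodic p f →
                     ∀ r i → ∃ λ j → j < p × f (r + j) ≡ f i
periodic-revisit-< {p = p} {f = f} per r i with t , eq ← periodic-revisit per r i =
  t % p , m%n<n t p ,
  trans (sym (periodic-% (periodic-shift per r) t)) (trans (cong f (+-comm r t)) eq)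

-- Finite readings of a sequence

applyUpTo-cong : ∀ {f g : ℕ → A} n → (∀ i → i < n → f i ≡ g i) → applyUpTo f n ≡ applyUpTo g n
applyUpTo-cong zero    eq = refl
applyUpTo-cong (suc n) eq = cong₂ _∷_ (eq 0 z<s) (applyUpTo-cong n λ i i<n → eq (suc i) (s≤s i<n))

applyUpTo-injective : ∀ {f g : ℕ → A} n → applyUpTo f n ≡ applyUpTo g n → ∀ i → i < n → f i ≡ g i
applyUpTo-injective (suc n) eq zero    _         = proj₁ (∷-injective eq)
applyUpTo-injective (suc n) eq (suc i) (s≤s i<n) = applyUpTo-injective n (proj₂ (∷-injective eq)) i i<n

applyUpTo-+ : ∀ (f : ℕ → A) m n → applyUpTo f (m + n) ≡ applyUpTo f m ++ applyUpTo (λ k → f (m + k)) n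
applyUpTo-+ f zero    n = refl
applyUpTo-+ f (suc m) n = cong (f 0 ∷_) (applyUpTo-+ (f ∘ suc) m n)

applyUpTo-const : ∀ (x : A) n → applyUpTo (λ _ → x) n ≡ replicate n x
applyUpTo-const x zero    = refl
applyUpTo-const x (suc n) = cong (x ∷_) (applyUpTo-const x n)

take-applyUpTo : ∀ (f : ℕ → A) {m n} → m ≤ n → take m (applyUpTo f n) ≡ applyUpTo f m
take-applyUpTo f z≤n       = refl
take-applyUpTo f (s≤s m≤n) = cong (f 0 ∷_) (take-applyUpTo (f ∘ suc) m≤n)

drop-applyUpTo : ∀ (f : ℕ → A) m n → drop m (applyUpTo f n) ≡ applyUpTo (λ k → f (m + k)) (n ∸ m)
drop-applyUpTo f zero    n       = refl
drop-applyUpTo f (suc m) zero    = refl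
drop-applyUpTo f (suc m) (suc n) = drop-applyUpTo (f ∘ suc) m n

applyUpTo-split : ∀ (f : ℕ → A) n U {V} → applyUpTo f n ≡ U ++ V → let r = length U in
                  r ≤ n × U ≡ applyUpTo f r × V ≡ applyUpTo (λ k → f (r + k)) (n ∸ r)
applyUpTo-split f n       []      eq = z≤n , refl , sym eq
applyUpTo-split f (suc n) (x ∷ U) eq
  with f0≡x , eq′ ← ∷-injective eq
  with r≤n , U≡ , V≡ ← applyUpTo-split (f ∘ suc) n U eq′
  = s≤s r≤n , cong₂ _∷_ (sym f0≡x) U≡ , V≡

-- The part moved to the end reads on after a full period, so a rotation only shifts the starting
-- index to the cut.
rotation-applyUpTo : ∀ {f : ℕ → Parity} → Periodic p f → ∀ {V} → Rotation (applyUpTo f p) V →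
                     ∃ λ r → V ≡ applyUpTo (λ k → f (r + k)) p
rotation-applyUpTo {p = p} {f} per (U , V , eq , refl)
  with r≤p , U≡ , V≡ ← applyUpTo-split f p U eq = r , (begin
  V ++ U                                                       ≡⟨ cong₂ _++_ V≡ U≡ ⟩
  applyUpTo g (p ∸ r) ++ applyUpTo f r                         ≡⟨ cong (applyUpTo g (p ∸ r) ++_) (applyUpTo-cong r λ k _ → wrap k) ⟩
  applyUpTo g (p ∸ r) ++ applyUpTo (λ k → g (p ∸ r + k)) r     ≡⟨ applyUpTo-+ g (p ∸ r) r ⟨
  applyUpTo g (p ∸ r + r)                                      ≡⟨ cong (applyUpTo g) (m∸n+n≡m r≤p) ⟩
  applyUpTo g p                                                ∎)
  where
  open ≡-Reasoning
  r = length U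
  g = λ k → f (r + k)
  wrap : ∀ k → f k ≡ g (p ∸ r + k)
  wrap k = sym (begin
    f (r + (p ∸ r + k))  ≡⟨ cong f (+-assoc r (p ∸ r) k) ⟨
    f (r + (p ∸ r) + k)  ≡⟨ cong (λ q → f (q + k)) (m+[n∸m]≡n r≤p) ⟩
    f (p + k)            ≡⟨ cong f (+-comm p k) ⟩
    f (k + p)            ≡⟨ per k ⟩
    f k                  ∎)

-- Windows and occurrences of words

toList-injective : {u v : Vec A n} → toList u ≡ toList v → u ≡ v
toList-injective {u = u} {v} eq = trans (sym (Vec.cast-is-id refl u)) (Vec.toList-injective refl u v eq)

window : ∀ n → (ℕ → A) → ℕ → Vec A n
window n f k = tabulate (λ j → f (k + toℕ j))

window-const : ∀ n (f : ℕ → A) k {x} → (∀ j → j < n → f (k + j) ≡ x) → window n f k ≡ Vec.replicate n x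
window-const n f k {x} eq = trans
  (Vec.tabulate-cong λ j → trans (eq (toℕ j) (Fin.toℕ<n j)) (sym (Vec.lookup-replicate j x)))
  (Vec.tabulate∘lookup (Vec.replicate n x))

window-cong : ∀ n (f : ℕ → A) k g l → (∀ j → j < n → f (k + j) ≡ g (l + j)) → window n f k ≡ window n g l
window-cong n f k g l eq = Vec.tabulate-cong λ j → eq (toℕ j) (Fin.toℕ<n j)

toList-window : ∀ n (f : ℕ → A) k → toList (window n f k) ≡ applyUpTo (λ j → f (k + j)) n
toList-window n f k = go n (λ j → f (k + j))
  where
  go : ∀ n (g : ℕ → _) → toList (tabulate {n = n} (g ∘ toℕ)) ≡ applyUpTo g n
  go zero    g = refl
  go (suc n) g = cong (g 0 ∷_) (go n (g ∘ suc))

window-∷ʳ : ∀ n (f : ℕ → A) k → window (suc n) f k ≡ window n f k ∷ʳ f (k + n)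
window-∷ʳ n f k = go n (λ j → f (k + j))
  where
  go : ∀ n (g : ℕ → _) → tabulate {n = suc n} (g ∘ toℕ) ≡ tabulate {n = n} (g ∘ toℕ) ∷ʳ g n
  go zero    g = refl
  go (suc n) g = cong (g 0 ∷_) (go n (g ∘ suc))

window-suc : ∀ n (f : ℕ → A) k →
             window (suc n) f (suc k) ≡ Vec.tail (window (suc n) f k) ∷ʳ f (k + suc n)
window-suc n f k = trans (window-∷ʳ n f (suc k))
  (cong₂ _∷ʳ_ (Vec.tabulate-cong λ j → cong f (sym (+-suc k (toℕ j)))) (cong f (sym (+-suc k n))))

window-periodic : ∀ n {f : ℕ → A} → Periodic p f → Periodic p (window n f)
window-periodic {p = p} n {f} per k = window-cong n f (k + p) f k λ j _ →
  trans (cong f (trans (+-assoc k p j) (trans (cong (k +_) (+-comm p j)) (sym (+-assoc k j p))))) (per (k + j))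

occursAt-bound : ∀ X i {u : Vec Parity (suc n)} → OccursAt X i u → i < length X ∸ n
occursAt-bound {n} X i {u} occ = m+n≤o⇒m≤o∸n (suc i) (begin
  suc i + n                              ≡⟨ +-suc i n ⟨
  i + suc n                              ≡⟨ cong (i +_) len ⟨
  i + (suc n ⊓ (length X ∸ i))           ≤⟨ +-monoʳ-≤ i (m⊓n≤n (suc n) _) ⟩
  i + (length X ∸ i)                     ≡⟨ m+[n∸m]≡n i≤ ⟩
  length X                               ∎)
  where
  open ≤-Reasoning
  -- `take` and `drop` truncate silently; comparing lengths shows that a whole word is left at `i`,
  -- which fails past the end.
  len : suc n ⊓ (length X ∸ i) ≡ suc n
  len = trans (cong (suc n ⊓_) (sym (length-drop i X)))
    (trans (sym (length-take (suc n) (drop i X))) (trans (cong length occ) (Vec.length-toList u)))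
  i≤ : i ≤ length X
  i≤ with ≤-total i (length X)
  ... | inj₁ i≤ = i≤
  ... | inj₂ X≤i = contradiction (trans (sym len) (cong (suc n ⊓_) (m≤n⇒m∸n≡0 X≤i))) λ ()

occursAt-applyUpTo : ∀ x p i (u : Vec Parity (suc n)) →
                     OccursAt (applyUpTo x (p + n)) i u ⇔ (i < p × u ≡ window (suc n) x i)
occursAt-applyUpTo {n} x p i u = mk⇔ to from
  where
  X = applyUpTo x (p + n)

  substring : i < p → take (suc n) (drop i X) ≡ toList (window (suc n) x i)
  substring i<p = trans (cong (take (suc n)) (drop-applyUpTo x i (p + n)))
    (trans (take-applyUpTo _ fits) (sym (toList-window (suc n) x i)))
    where
    fits : suc n ≤ p + n ∸ i
    fits = m+n≤o⇒m≤o∸n (suc n) (≤-trans (≤-reflexive (cong suc (+-comm n i))) (+-monoˡ-≤ n i<p))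

  to : OccursAt X i u → i < p × u ≡ window (suc n) x i
  to occ = i<p , toList-injective (trans (sym occ) (substring i<p))
    where
    i<p : i < p
    i<p = subst (i <_) (trans (cong (_∸ n) (length-applyUpTo x (p + n))) (m+n∸n≡m p n)) (occursAt-bound X i occ)

  from : i < p × u ≡ window (suc n) x i → OccursAt X i u
  from (i<p , refl) = substring i<p

-- Counting

-- Pigeonhole: if `f` missed `v`, removing the code `e v` would squeeze `suc n` distinct codes into
-- `Fin n`.
injective⇒surjective : ∀ {f : Fin n → A} {e : A → Fin n} →
                       Injective _≡_ _≡_ f → Injective _≡_ _≡_ e → ∀ v → ∃ λ i → f i ≡ v
injective⇒surjective {n = zero}  {e = e} f-inj e-inj v = contradiction (e v) λ ()
injective⇒surjective {n = suc n} {f = f} {e} f-inj e-inj v with Fin.any? (λ i → e v Fin.≟ e (f i))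
... | yes (i , eq) = i , sym (e-inj eq)
... | no ∄i = contradiction
  (Fin.injective⇒≤ λ {i} {j} eq → f-inj (e-inj (Fin.punchOut-injective (λ eq → ∄i (i , eq)) (λ eq → ∄i (j , eq)) eq)))
  1+n≰n

parityToFin : Parity → Fin 2
parityToFin 0ℙ = 0F
parityToFin 1ℙ = 1F

parityToFin-injective : Injective _≡_ _≡_ parityToFin
parityToFin-injective {0ℙ} {0ℙ} _ = refl
parityToFin-injective {1ℙ} {1ℙ} _ = refl

encode : Vec Parity n → Fin (2 ^ n)
encode v = funToFin (parityToFin ∘ lookup v)

encode-injective : Injective _≡_ _≡_ (encode {n})
encode-injective {n} {u} {v} eq = trans (sym (Vec.tabulate∘lookup u))
  (trans (Vec.tabulate-cong λ i → parityToFin-injective (lookup-eq i)) (Vec.tabulate∘lookup v))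
  where
  lookup-eq : ∀ i → parityToFin (lookup u i) ≡ parityToFin (lookup v i)
  lookup-eq i = trans (sym (Fin.finToFun-funToFin (parityToFin ∘ lookup u) i))
    (trans (cong (λ k → Fin.finToFun {2} {n} k i) eq) (Fin.finToFun-funToFin (parityToFin ∘ lookup v) i))

-- Distinct words occur at distinct positions, and `Y` has at most `length Y ∸ n` positions for
-- words of length `suc n`.
containsAll⇒long : ∀ {g : Fin p → Vec Parity (suc n)} → Injective _≡_ _≡_ g →
                   ∀ Y → ContainsAll (suc n) Y → p ≤ length Y ∸ n
containsAll⇒long {n = n} {g} g-inj Y all = Fin.injective⇒≤ {f = pos} λ {i} {j} eq →
  g-inj (toList-injective (trans (sym (proj₂ (all (g i))))
    (trans (cong (λ k → take (suc n) (drop k Y)) (Fin.fromℕ<-injective _ _ _ _ eq)) (proj₂ (all (g j))))))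
  where
  pos : Fin _ → Fin (length Y ∸ n)
  pos i = fromℕ< (occursAt-bound Y (proj₁ (all (g i))) (proj₂ (all (g i))))

n<2^n : ∀ n → n < 2 ^ n
n<2^n zero    = z<s
n<2^n (suc n) = ≤-trans (+-mono-≤ (m^n>0 2 n) (n<2^n n)) (≤-reflexive (cong (2 ^ n +_) (sym (+-identityʳ (2 ^ n)))))

-- Shift registers

0s 1s : ∀ n → Vec Parity n
0s n = Vec.replicate n 0ℙ
1s n = Vec.replicate n 1ℙ

_≟_ : (u v : Vec Parity n) → Dec (u ≡ v)
_≟_ = Vec.≡-dec ℙ._≟_

replicate-∷ʳ : ∀ n (x : A) → Vec.replicate n x ∷ʳ x ≡ Vec.replicate (suc n) x
replicate-∷ʳ zero    x = refl
replicate-∷ʳ (suc n) x = cong (x ∷_) (replicate-∷ʳ n x)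

∷ʳ-replicate : ∀ {ρ : Vec A n} {x y} → ρ ∷ʳ y ≡ Vec.replicate (suc n) x → ρ ≡ Vec.replicate n x × y ≡ x
∷ʳ-replicate {n = n} {ρ} {x} eq = Vec.∷ʳ-injective ρ _ (trans eq (sym (replicate-∷ʳ n x)))

≢⇒≡⁻¹ : ∀ {x y} → x ≢ y → x ≡ y ⁻¹
≢⇒≡⁻¹ {0ℙ} {0ℙ} x≢y = contradiction refl x≢y
≢⇒≡⁻¹ {0ℙ} {1ℙ} x≢y = refl
≢⇒≡⁻¹ {1ℙ} {0ℙ} x≢y = refl
≢⇒≡⁻¹ {1ℙ} {1ℙ} x≢y = contradiction refl x≢y

complement : Vec Parity n → Vec Parity n
complement = Vec.map _⁻¹

complement-involutive : (v : Vec Parity n) → complement (complement v) ≡ v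
complement-involutive v =
  trans (sym (Vec.map-∘ _⁻¹ _⁻¹ v)) (trans (Vec.map-cong ℙ.⁻¹-involutive v) (Vec.map-id v))

Feedback : ℕ → Set
Feedback n = Vec Parity (suc n) → Parity

step : Feedback n → Vec Parity (suc n) → Vec Parity (suc n)
step F (x ∷ ρ) = ρ ∷ʳ F (x ∷ ρ)

-- `opposite` is there because `c i` weighs the digit `suc (toℕ i)` places back, while a window
-- lists its oldest digit first.
linear : (Fin (suc n) → Parity) → Feedback n
linear c v = sum λ i → c i ℙ.* lookup v (opposite i)

linear-0s : ∀ (c : Fin (suc n) → Parity) → linear c (0s (suc n)) ≡ 0ℙ
linear-0s {n} c = trans
  (sum-cong-≗ λ i → trans (cong (c i ℙ.*_) (Vec.lookup-replicate (opposite i) 0ℙ)) (ℙ.*-zeroʳ (c i)))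
  (sum-replicate-zero (suc n))

-- Complementing adds the word 1...1, and `linear c` is additive.
linear-complement : ∀ (c : Fin (suc n) → Parity) v → linear c (complement v) ≡ linear c v ℙ.+ linear c (1s (suc n))
linear-complement {n} c v = trans (sum-cong-≗ pointwise)
  (∑-distrib-+ (λ i → c i ℙ.* lookup v (opposite i)) λ i → c i ℙ.* lookup (1s (suc n)) (opposite i))
  where
  open ≡-Reasoning
  ⁻¹≡+1 : ∀ x → x ⁻¹ ≡ x ℙ.+ 1ℙ
  ⁻¹≡+1 0ℙ = refl
  ⁻¹≡+1 1ℙ = refl
  pointwise : ∀ i → c i ℙ.* lookup (complement v) (opposite i)
                  ≡ c i ℙ.* lookup v (opposite i) ℙ.+ (c i ℙ.* lookup (1s (suc n)) (opposite i))
  pointwise i = begin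
    c i ℙ.* lookup (complement v) (opposite i)     ≡⟨ cong (c i ℙ.*_) (Vec.lookup-map (opposite i) _⁻¹ v) ⟩
    c i ℙ.* lookup v (opposite i) ⁻¹               ≡⟨ cong (c i ℙ.*_) (⁻¹≡+1 (lookup v (opposite i))) ⟩
    c i ℙ.* (lookup v (opposite i) ℙ.+ 1ℙ)         ≡⟨ ℙ.*-distribˡ-+ (c i) (lookup v (opposite i)) 1ℙ ⟩
    c i ℙ.* lookup v (opposite i) ℙ.+ (c i ℙ.* 1ℙ)
      ≡⟨ cong (λ x → c i ℙ.* lookup v (opposite i) ℙ.+ (c i ℙ.* x)) (Vec.lookup-replicate (opposite i) 1ℙ) ⟨
    c i ℙ.* lookup v (opposite i) ℙ.+ (c i ℙ.* lookup (1s (suc n)) (opposite i)) ∎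

recurrence⇒linear : ∀ (c : Fin (suc n) → Parity) a → Recurrence (suc n) c a →
                    ∀ k → a (k + suc n) ≡ linear c (window (suc n) a k)
recurrence⇒linear {n} c a rec k = trans (rec k) (sum-cong-≗ λ i → cong (c i ℙ.*_) (sym (begin
  lookup (window (suc n) a k) (opposite i)   ≡⟨ Vec.lookup∘tabulate (λ j → a (k + toℕ j)) (opposite i) ⟩
  a (k + toℕ (opposite i))                   ≡⟨ cong (λ j → a (k + j)) (Fin.opposite-prop i) ⟩
  a (k + (suc n ∸ suc (toℕ i)))              ≡⟨ cong a (+-∸-assoc k (Fin.toℕ<n i)) ⟨
  a ((k + suc n) ∸ suc (toℕ i))              ∎)))
  where open ≡-Reasoning

-- For complement-invariant `F`, complementation conjugates the register of `F` to that of 1 + `F`,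
-- so orbits of the one give orbits of the other.
step-complement : ∀ (F : Feedback n) → (∀ v → F (complement v) ≡ F v) →
                  ∀ v → complement (step F v) ≡ step (_⁻¹ ∘ F) (complement v)
step-complement F F-complement v@(x ∷ ρ) = trans (Vec.map-∷ʳ _⁻¹ (F v) ρ)
  (cong (λ y → complement ρ ∷ʳ y ⁻¹) (sym (F-complement v)))

-- PN sequences

PNSequence-shift : ∀ {a} → PNSequence n a → ∀ r → PNSequence n (λ k → a (r + k))
PNSequence-shift {n} {a} pn r = record
  { coefficients = coefficients
  ; recurrence   = λ k → trans (cong a (sym (+-assoc r k n))) (trans (recurrence (r + k))
      (sum-cong-≗ λ i → cong (λ j → coefficients i ℙ.* a j)
        (trans (cong (_∸ suc (toℕ i)) (+-assoc r k n))
          (+-∸-assoc r (≤-trans (Fin.toℕ<n i) (m≤n+m n k))))))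
  ; period       = (0<N , periodic-shift a-periodic r) , λ q (0<q , q-periodic) →
      proj₂ period q (0<q , λ k →
        -- A period `q` of the shifted sequence only concerns indices from `r` on. Every pair of
        -- values at distance `q` recurs there, so `q` is a period of `a` as well.
        let t , revisit = periodic-revisit {{>-nonZero 0<N}} (periodic-pair a-periodic q) r k
            ak+q≡ , ak≡ = ,-injective revisit
        in trans (sym ak+q≡) (trans (cong a (trans (cong (_+ q) (+-comm t r)) (+-assoc r t q)))
             (trans (q-periodic t) (trans (cong a (+-comm r t)) ak≡))))
  }
  where
  open PNSequence pn
  N = 2 ^ n ∸ 1
  0<N : 0 < N
  0<N = proj₁ (proj₁ period)
  a-periodic : Periodic N a
  a-periodic = proj₂ (proj₁ period)

module PN {m} {a} (pn : PNSequence (suc (suc m)) a) where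
  open PNSequence pn

  ℓ N : ℕ
  ℓ = suc m
  N = 2 ^ suc ℓ ∸ 1

  L : Feedback ℓ
  L = linear coefficients

  L-0s : L (0s (suc ℓ)) ≡ 0ℙ
  L-0s = linear-0s coefficients

  state : ℕ → Vec Parity (suc ℓ)
  state = window (suc ℓ) a

  1+N≡2^n : suc N ≡ 2 ^ suc ℓ
  1+N≡2^n = m+[n∸m]≡n (m^n>0 2 (suc ℓ))

  -- The order is at least 2 here; for order 1 the period would be 1 and fixed points could not be
  -- excluded.
  1<N : 1 < N
  1<N = ∸-monoˡ-≤ 1 (≤-trans (n≤1+n 3) (^-monoʳ-≤ 2 {2} {suc ℓ} (s≤s (s≤s z≤n))))

  instance
    N-nonZero : NonZero N
    N-nonZero = >-nonZero (<-trans z<s 1<N)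

  ℓ≤N : ℓ ≤ N
  ℓ≤N = s≤s⁻¹ (subst (suc ℓ ≤_) (sym 1+N≡2^n) (<⇒≤ (n<2^n (suc ℓ))))

  a-periodic : Periodic N a
  a-periodic = proj₂ (proj₁ period)

  state-periodic : Periodic N state
  state-periodic = window-periodic (suc ℓ) a-periodic

  state-suc : ∀ k → state (suc k) ≡ step L (state k)
  state-suc k = trans (window-suc ℓ a k) (cong (Vec.tail (state k) ∷ʳ_) (recurrence⇒linear coefficients a recurrence k))

  state-+ : ∀ {i j} → state i ≡ state j → ∀ t → state (t + i) ≡ state (t + j)
  state-+ eq zero    = eq
  state-+ eq (suc t) = trans (state-suc _) (trans (cong (step L) (state-+ eq t)) (sym (state-suc _)))

  head-state : ∀ k → Vec.head (state k) ≡ a k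
  head-state k = cong a (+-identityʳ k)

  -- A state determines all later ones, so `d` is a period from index `i` on, hence everywhere by
  -- periodicity of `a`; and `N` is the least period.
  repeated⇒N≤ : ∀ i {d} → 0 < d → state i ≡ state (i + d) → N ≤ d
  repeated⇒N≤ i {d} 0<d eq = proj₂ period d (0<d , λ k →
    let t , revisit = periodic-revisit (periodic-pair a-periodic d) i k
        ak+d≡ , ak≡ = ,-injective revisit
    in trans (sym ak+d≡) (trans (sym (at t)) ak≡))
    where
    at : ∀ t → a (t + i) ≡ a (t + i + d)
    at t = trans (sym (head-state (t + i))) (trans (cong Vec.head (state-+ eq t))
      (trans (head-state (t + (i + d))) (cong a (sym (+-assoc t i d)))))

  state-≢ : ∀ {i j} → i < j → j < N → state i ≢ state j
  state-≢ {i} {j} i<j j<N eq = <⇒≱ j<N (≤-trans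
    (repeated⇒N≤ i (m<n⇒0<n∸m i<j) (trans eq (cong state (sym (m+[n∸m]≡n (<⇒≤ i<j))))))
    (m∸n≤m j i))

  state-injective : ∀ {i j} → i < N → j < N → state i ≡ state j → i ≡ j
  state-injective {i} {j} i<N j<N eq with <-cmp i j
  ... | tri< i<j _ _ = contradiction eq (state-≢ i<j j<N)
  ... | tri≈ _ i≡j _ = i≡j
  ... | tri> _ _ j<i = contradiction (sym eq) (state-≢ j<i i<N)

  fixed-point-free : ∀ k → step L (state k) ≢ state k
  fixed-point-free k eq = <⇒≱ 1<N (repeated⇒N≤ k z<s
    (trans (sym eq) (trans (sym (state-suc k)) (cong state (sym (+-comm k 1))))))

  state≢0s : ∀ k → state k ≢ 0s (suc ℓ)
  state≢0s k eq = fixed-point-free k (trans (cong (step L) eq)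
    (trans (cong (0s ℓ ∷ʳ_) L-0s) (trans (replicate-∷ʳ ℓ 0ℙ) (sym eq))))

  -- The zero word together with the states of one period: these are `2 ^ suc ℓ` distinct words, so
  -- every word is among them.
  word : Fin (suc N) → Vec Parity (suc ℓ)
  word zero    = 0s (suc ℓ)
  word (suc i) = state (toℕ i)

  word-injective : Injective _≡_ _≡_ word
  word-injective {zero}  {zero}  _  = refl
  word-injective {zero}  {suc j} eq = contradiction (sym eq) (state≢0s (toℕ j))
  word-injective {suc i} {zero}  eq = contradiction eq (state≢0s (toℕ i))
  word-injective {suc i} {suc j} eq =
    cong suc (Fin.toℕ-injective (state-injective (Fin.toℕ<n i) (Fin.toℕ<n j) eq))

  word-surjective : ∀ v → ∃ λ i → word i ≡ v
  word-surjective = injective⇒surjective {e = subst Fin (sym 1+N≡2^n) ∘ encode}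
    word-injective (encode-injective ∘ subst-injective (sym 1+N≡2^n))

  visited : ∀ {v} → v ≢ 0s (suc ℓ) → ∃ λ k → state k ≡ v
  visited {v} v≢0 with word-surjective v
  ... | zero  , eq = contradiction (sym eq) v≢0
  ... | suc i , eq = toℕ i , eq

  -- The nonzero words form a single cycle of `step L`, so a property preserved along it spreads
  -- from any one of them to all.
  orbit-induction : (Q : Vec Parity (suc ℓ) → Set) → (∀ v → Q v → Q (step L v)) →
                    ∀ {u} → u ≢ 0s (suc ℓ) → Q u → ∀ {v} → v ≢ 0s (suc ℓ) → Q v
  orbit-induction Q closed u≢0 qu v≢0 with i , refl ← visited u≢0 | j , refl ← visited v≢0
    with t , eq ← periodic-revisit state-periodic i j = subst Q eq (go t)
    where
    go : ∀ t → Q (state (t + i))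
    go zero    = qu
    go (suc t) = subst Q (sym (state-suc (t + i))) (closed _ (go t))

  step≢0s : ∀ {v} → v ≢ 0s (suc ℓ) → step L v ≢ 0s (suc ℓ)
  step≢0s v≢0 with k , refl ← visited v≢0 = λ eq → state≢0s (suc k) (trans (state-suc k) eq)

  -- Otherwise 10...0 would step to 0...0, but the orbit of a nonzero word avoids 0...0.
  L-unit : L (1ℙ ∷ 0s ℓ) ≡ 1ℙ
  L-unit = ≢⇒≡⁻¹ λ L≡0 → step≢0s {1ℙ ∷ 0s ℓ} (λ ()) (trans (cong (0s ℓ ∷ʳ_) L≡0) (replicate-∷ʳ ℓ 0ℙ))

  -- Otherwise 1...1 would be a fixed point on the long orbit.
  L-1s : L (1s (suc ℓ)) ≡ 0ℙ
  L-1s = ≢⇒≡⁻¹ λ L≡1 → let k , eq = visited {1s (suc ℓ)} (λ ()) in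
    fixed-point-free k (trans (cong (step L) eq)
      (trans (cong (1s ℓ ∷ʳ_) L≡1) (trans (replicate-∷ʳ ℓ 1ℙ) (sym eq))))

  L-complement : ∀ v → L (complement v) ≡ L v
  L-complement v = trans (linear-complement coefficients v) (trans (cong (L v ℙ.+_) L-1s) (ℙ.+-identityʳ (L v)))

-- The cycle with the extra zero

module Cycle {m} {a} (pn : PNSequence (suc (suc m)) a) (a-zeros : ∀ j → j < suc m → a j ≡ 0ℙ) where
  open PN pn

  P : ℕ
  P = suc N

  0∷a : ℕ → Parity
  0∷a zero    = 0ℙ
  0∷a (suc k) = a k

  0∷a-zeros : ∀ k → k < suc ℓ → 0∷a k ≡ 0ℙ
  0∷a-zeros zero    _         = refl
  0∷a-zeros (suc k) (s≤s k<ℓ) = a-zeros k k<ℓ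

  -- The De Bruijn cycle unrolled into an infinite sequence of period `P`; rotations and associated
  -- strings then become stretches of `z`.
  z : ℕ → Parity
  z k = 0∷a (k % P)

  z-periodic : Periodic P z
  z-periodic k = cong 0∷a ([m+n]%n≡m%n k P)

  -- The zeros at the start of a make the first lap of z agree with 0 ∷ a for ℓ more digits.
  z≡0∷a : ∀ {k} → k < P + ℓ → z k ≡ 0∷a k
  z≡0∷a {k} k<P+ℓ with k <? P
  ... | yes k<P = cong 0∷a (m<n⇒m%n≡m k<P)
  ... | no  k≮P = subst (λ k → z k ≡ 0∷a k) (m∸n+n≡m P≤k) (trans (z-periodic j) (trans
          (trans (cong 0∷a (m<n⇒m%n≡m (<-≤-trans j<ℓ (m≤n⇒m≤1+n ℓ≤N)))) (0∷a-zeros j (m<n⇒m<1+n j<ℓ)))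
          (sym (trans (cong 0∷a (+-suc j N)) (trans (a-periodic j) (a-zeros j j<ℓ))))))
    where
    P≤k : P ≤ k
    P≤k = ≮⇒≥ k≮P
    j : ℕ
    j = k ∸ P
    j<ℓ : j < ℓ
    j<ℓ = +-cancelʳ-< P j ℓ (subst₂ _<_ (sym (m∸n+n≡m P≤k)) (+-comm P ℓ) k<P+ℓ)

  factor : ℕ → Vec Parity (suc ℓ)
  factor = window (suc ℓ) z

  factor-periodic : Periodic P factor
  factor-periodic = window-periodic (suc ℓ) z-periodic

  factor-zero : factor 0 ≡ 0s (suc ℓ)
  factor-zero = window-const (suc ℓ) z 0 λ j j<1+ℓ →
    trans (z≡0∷a (≤-trans j<1+ℓ (s≤s (m≤n+m ℓ N)))) (0∷a-zeros j j<1+ℓ)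

  factor-suc : ∀ {j} → j < N → factor (suc j) ≡ state j
  factor-suc {j} j<N = window-cong (suc ℓ) z (suc j) a j λ i i<1+ℓ → z≡0∷a (s≤s (+-mono-<-≤ j<N (s≤s⁻¹ i<1+ℓ)))

  factor-surjective : ∀ u → ∃ λ i → factor i ≡ u
  factor-surjective u with word-surjective u
  ... | zero  , eq = 0 , trans factor-zero eq
  ... | suc i , eq = suc (toℕ i) , trans (factor-suc (Fin.toℕ<n i)) eq

  -- The run of `ℓ` zeros must be followed by 1, since no state is 0...0.
  state-zero : state 0 ≡ 0s ℓ ∷ʳ 1ℙ
  state-zero = trans (window-∷ʳ ℓ a 0) (cong₂ _∷ʳ_ ℓ-zeros (≢⇒≡⁻¹ λ aℓ≡0 → state≢0s 0
    (trans (window-∷ʳ ℓ a 0) (trans (cong₂ _∷ʳ_ ℓ-zeros aℓ≡0) (replicate-∷ʳ ℓ 0ℙ)))))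
    where
    ℓ-zeros : window ℓ a 0 ≡ 0s ℓ
    ℓ-zeros = window-const ℓ a 0 a-zeros

  -- Inserting the zero reroutes 10…0 → 0…01 through 0…0.
  F : Feedback ℓ
  F (x ∷ ρ) with ρ ≟ 0s ℓ
  ... | yes _ = x ⁻¹
  ... | no  _ = L (x ∷ ρ)

  F-0s : ∀ x → F (x ∷ 0s ℓ) ≡ x ⁻¹
  F-0s x with 0s ℓ ≟ 0s ℓ
  ... | yes _   = refl
  ... | no  0≢0 = contradiction refl 0≢0

  F-≢0s : ∀ x {ρ} → ρ ≢ 0s ℓ → F (x ∷ ρ) ≡ L (x ∷ ρ)
  F-≢0s x {ρ} ρ≢0 with ρ ≟ 0s ℓ
  ... | yes ρ≡0 = contradiction ρ≡0 ρ≢0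
  ... | no  _   = refl

  -- Returning to the initial state takes at least `N` steps.
  state-last : ∀ {j} → j < N → state (suc j) ≡ state 0 → suc j ≡ N
  state-last j<N eq = ≤-antisym j<N (repeated⇒N≤ 0 z<s (sym eq))

  step-F-state : ∀ {j} → j < N → ∀ {v} → state j ≡ v → factor (suc (suc j)) ≡ step F v
  step-F-state {j} j<N {x ∷ ρ} eq with ρ ≟ 0s ℓ
  step-F-state {j} j<N {0ℙ ∷ _} eq | yes refl = contradiction eq (state≢0s j)
  -- The successor of 10...0 under `L` is `state 0`, so this is the last state of the lap. The next
  -- factor is that of the following lap, 0...0.
  step-F-state {j} j<N {1ℙ ∷ _} eq | yes refl = trans (cong (factor ∘ suc) (state-last j<N
    (trans (state-suc j) (trans (cong (step L) eq) (trans (cong (0s ℓ ∷ʳ_) L-unit) (sym state-zero))))))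
    (trans (factor-periodic 0) (trans factor-zero (sym (replicate-∷ʳ ℓ 0ℙ))))
  step-F-state {j} j<N {x ∷ ρ}  eq | no ρ≢0 = trans (factor-suc 1+j<N) state-1+j
    where
    state-1+j : state (suc j) ≡ step L (x ∷ ρ)
    state-1+j = trans (state-suc j) (cong (step L) eq)
    -- If the lap ended here, the next state would be 0...01, forcing the tail `ρ` to be 0...0.
    1+j<N : suc j < N
    1+j<N = ≤∧≢⇒< j<N λ 1+j≡N → ρ≢0 (Vec.∷ʳ-injectiveˡ ρ (0s ℓ)
      (trans (sym state-1+j) (trans (cong state 1+j≡N) (trans (state-periodic 0) state-zero))))

  factor-step : ∀ i → factor (suc i) ≡ step F (factor i)
  factor-step i = trans (periodic-% (λ k → factor-periodic (suc k)) i)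
    (trans (first-lap (i % P) (m%n<n i P)) (cong (step F) (sym (periodic-% factor-periodic i))))
    where
    first-lap : ∀ k → k < P → factor (suc k) ≡ step F (factor k)
    first-lap zero    _         = trans (factor-suc (<-trans z<s 1<N)) (trans state-zero
      (trans (cong (0s ℓ ∷ʳ_) (sym (F-0s 0ℙ))) (cong (step F) (sym factor-zero))))
    first-lap (suc j) (s≤s j<N) = step-F-state j<N (sym (factor-suc j<N))

  -- The circuit of an associated string

  module _ (r : ℕ) where

    x : ℕ → Parity
    x k = z (r + k)

    X : List Parity
    X = applyUpTo x (P + ℓ)

    window-x : ∀ i → window (suc ℓ) x i ≡ factor (r + i)
    window-x i = window-cong (suc ℓ) x i z (r + i) λ j _ → cong z (sym (+-assoc r i j))

    occurs : ∀ u → ∃ λ i → i < P × u ≡ window (suc ℓ) x i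
    occurs u with i , eq ← factor-surjective u
      with j , j<P , eq′ ← periodic-revisit-< factor-periodic r i =
      j , j<P , sym (trans (window-x j) (trans eq′ eq))

    window-x-suc : ∀ i → window (suc ℓ) x (suc i) ≡ step F (window (suc ℓ) x i)
    window-x-suc i = trans (window-x (suc i)) (trans (cong factor (+-suc r i))
      (trans (factor-step (r + i)) (cong (step F) (sym (window-x i)))))

    length-X∸n : length X ∸ suc ℓ ≡ N
    length-X∸n = trans (cong (_∸ suc ℓ) (length-applyUpTo x (P + ℓ)))
      (trans (cong (_∸ suc ℓ) (sym (+-suc N ℓ))) (m+n∸n≡m N (suc ℓ)))

    -- Position `N` holds the last word; one step further is position `P`, which repeats position 0.
    window-x-closes : window (suc ℓ) x 0 ≡ step F (window (suc ℓ) x N)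
    window-x-closes = trans (sym (window-periodic (suc ℓ) (periodic-shift z-periodic r) 0)) (window-x-suc N)

    occursAt⇒window : ∀ i u → OccursAt X i u → u ≡ window (suc ℓ) x i
    occursAt⇒window i u = proj₂ ∘ Equivalence.to (occursAt-applyUpTo x P i u)

    occursAt-window : ∀ {i} → i < P → OccursAt X i (window (suc ℓ) x i)
    occursAt-window {i} i<P = Equivalence.from (occursAt-applyUpTo x P i _) (i<P , refl)

    -- Together with `step⇒circuit` this makes the circuit, closing edge included, exactly the graph
    -- of `step F`.
    circuit⇒step : ∀ {u v} → CircuitEdge (suc ℓ) X u v → v ≡ step F u
    circuit⇒step {u} {v} (inj₁ (i , at-i , at-1+i)) = trans (occursAt⇒window (suc i) v at-1+i)
      (trans (window-x-suc i) (cong (step F) (sym (occursAt⇒window i u at-i))))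
    circuit⇒step {u} {v} (inj₂ (at-last , at-0)) = trans (occursAt⇒window 0 v at-0)
      (trans window-x-closes (cong (step F)
        (sym (occursAt⇒window N u (subst (λ i → OccursAt X i u) length-X∸n at-last)))))

    circuit-at : ∀ {i} → i < N ⊎ i ≡ N → CircuitEdge (suc ℓ) X (window (suc ℓ) x i) (step F (window (suc ℓ) x i))
    circuit-at {i} (inj₁ i<N) = inj₁ (i , occursAt-window (m<n⇒m<1+n i<N)
      , subst (OccursAt X (suc i)) (window-x-suc i) (occursAt-window (s≤s i<N)))
    circuit-at (inj₂ refl) = inj₂
      ( subst (λ j → OccursAt X j (window (suc ℓ) x N)) (sym length-X∸n) (occursAt-window ≤-refl)
      , subst (OccursAt X 0) window-x-closes (occursAt-window z<s))

    step⇒circuit : ∀ u → CircuitEdge (suc ℓ) X u (step F u)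
    step⇒circuit u = let i , i<P , u≡ = occurs u in
      subst (λ v → CircuitEdge (suc ℓ) X v (step F v)) (sym u≡) (circuit-at (m≤n⇒m<n∨m≡n (s≤s⁻¹ i<P)))

    deBruijnString : DeBruijnString (suc ℓ) X
    deBruijnString = record
      { containsAll = λ u → let i , occ = occurs u in i , Equivalence.from (occursAt-applyUpTo x P i u) occ
      ; minimal     = λ Y all → subst (_≤ length Y) (sym (length-applyUpTo x (P + ℓ)))
          (long Y (containsAll⇒long word-injective Y all))
      }
      where
      long : ∀ Y → P ≤ length Y ∸ ℓ → P + ℓ ≤ length Y
      -- `P` is positive, so `length Y ∸ ℓ` is nonzero and hence an untruncated difference.
      long Y P≤ = m≤o∸n⇒m+n≤o P (<⇒≤ (m∸n≢0⇒n<m (λ eq → n≮0 (subst (P ≤_) eq P≤)))) P≤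

    -- The remaining edges

    G : Feedback ℓ
    G = _⁻¹ ∘ F

    Remaining : Rel (Vec Parity (suc ℓ)) 0ℓ
    Remaining = RemainingEdge (suc ℓ) X

    -- The two successors of a word differ only in the last digit, and the circuit uses the one with
    -- digit `F`.
    remaining⇒step : ∀ {u v} → Remaining u v → v ≡ step G u
    remaining⇒step (edge b ρ y , ¬circuit) = cong (ρ ∷ʳ_) (≢⇒≡⁻¹ λ y≡F →
      ¬circuit (subst (CircuitEdge (suc ℓ) X (b ∷ ρ)) (cong (ρ ∷ʳ_) (sym y≡F)) (step⇒circuit (b ∷ ρ))))

    step⇒remaining : ∀ u → Remaining u (step G u)
    step⇒remaining (b ∷ ρ) = edge b ρ (G (b ∷ ρ)) , λ circuit →
      ℙ.p≢p⁻¹ (F (b ∷ ρ)) (sym (Vec.∷ʳ-injectiveʳ ρ ρ (circuit⇒step circuit)))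

    G-0s : ∀ b → G (b ∷ 0s ℓ) ≡ b
    G-0s b = trans (cong _⁻¹ (F-0s b)) (ℙ.⁻¹-involutive b)

    -- The word 01...1 is the complement of 10...0, so `L` has the value 1 on both.
    G-0∷1s : G (0ℙ ∷ 1s ℓ) ≡ 0ℙ
    G-0∷1s = cong _⁻¹ (trans (F-≢0s 0ℙ (λ ())) (trans (cong L (cong (0ℙ ∷_) (sym (Vec.map-replicate _⁻¹ 0ℙ ℓ))))
      (trans (L-complement (1ℙ ∷ 0s ℓ)) L-unit)))

    step-G-0s : step G (0s (suc ℓ)) ≡ 0s (suc ℓ)
    step-G-0s = trans (cong (0s ℓ ∷ʳ_) (G-0s 0ℙ)) (replicate-∷ʳ ℓ 0ℙ)

    step-G-1s : step G (1s (suc ℓ)) ≡ 1s (suc ℓ)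
    step-G-1s = trans (cong (1s ℓ ∷ʳ_) (cong _⁻¹ (trans (F-≢0s 1ℙ (λ ())) L-1s))) (replicate-∷ʳ ℓ 1ℙ)

    -- The tail of a predecessor must be 0...0, and there `G` returns the leading digit.
    step-G≡0s : ∀ u → step G u ≡ 0s (suc ℓ) → u ≡ 0s (suc ℓ)
    step-G≡0s (b ∷ ρ) eq with refl , G≡0 ← ∷ʳ-replicate eq = cong (_∷ 0s ℓ) (trans (sym (G-0s b)) G≡0)

    -- The only other candidate is 01...1, but `G` appends 0 to it.
    step-G≡1s : ∀ u → step G u ≡ 1s (suc ℓ) → u ≡ 1s (suc ℓ)
    step-G≡1s (1ℙ ∷ ρ) eq = cong (1ℙ ∷_) (proj₁ (∷ʳ-replicate eq))
    step-G≡1s (0ℙ ∷ ρ) eq with refl , G≡1 ← ∷ʳ-replicate eq = contradiction (trans (sym G-0∷1s) G≡1) λ ()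

    -- Connected components of the remaining edges

    class : Vec Parity (suc ℓ) → Fin 3
    class u with u ≟ 0s (suc ℓ) | u ≟ 1s (suc ℓ)
    ... | yes _ | _     = 0F
    ... | no _  | yes _ = 1F
    ... | no _  | no _  = 2F

    class≡0⇒ : ∀ u → class u ≡ 0F → u ≡ 0s (suc ℓ)
    class≡0⇒ u eq with u ≟ 0s (suc ℓ) | u ≟ 1s (suc ℓ)
    class≡0⇒ u _  | yes u≡0 | _     = u≡0
    class≡0⇒ u () | no _    | yes _
    class≡0⇒ u () | no _    | no _

    class≡1⇒ : ∀ u → class u ≡ 1F → u ≡ 1s (suc ℓ)
    class≡1⇒ u eq with u ≟ 0s (suc ℓ) | u ≟ 1s (suc ℓ)
    class≡1⇒ u () | yes _ | _
    class≡1⇒ u _  | no _  | yes u≡1 = u≡1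
    class≡1⇒ u () | no _  | no _

    class≡2⇒ : ∀ u → class u ≡ 2F → u ≢ 0s (suc ℓ) × u ≢ 1s (suc ℓ)
    class≡2⇒ u eq with u ≟ 0s (suc ℓ) | u ≟ 1s (suc ℓ)
    class≡2⇒ u () | yes _  | _
    class≡2⇒ u () | no _   | yes _
    class≡2⇒ u _  | no u≢0 | no u≢1 = u≢0 , u≢1

    class-0s : class (0s (suc ℓ)) ≡ 0F
    class-0s with 0s (suc ℓ) ≟ 0s (suc ℓ) | 0s (suc ℓ) ≟ 1s (suc ℓ)
    ... | yes _  | _ = refl
    ... | no 0≢0 | _ = contradiction refl 0≢0

    class-1s : class (1s (suc ℓ)) ≡ 1F
    class-1s with 1s (suc ℓ) ≟ 0s (suc ℓ) | 1s (suc ℓ) ≟ 1s (suc ℓ)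
    ... | no _ | yes _  = refl
    ... | no _ | no 1≢1 = contradiction refl 1≢1

    class-other : ∀ {u} → u ≢ 0s (suc ℓ) → u ≢ 1s (suc ℓ) → class u ≡ 2F
    class-other {u} u≢0 u≢1 with u ≟ 0s (suc ℓ) | u ≟ 1s (suc ℓ)
    ... | yes u≡0 | _       = contradiction u≡0 u≢0
    ... | no _    | yes u≡1 = contradiction u≡1 u≢1
    ... | no _    | no _    = refl

    -- The two constant words are fixed by `step G` and have no other predecessors, so no edge
    -- leaves a class.
    class-step : ∀ u k → class u ≡ k → class (step G u) ≡ k
    class-step u 0F eq = trans (cong (class ∘ step G) (class≡0⇒ u eq)) (trans (cong class step-G-0s) class-0s)
    class-step u 1F eq = trans (cong (class ∘ step G) (class≡1⇒ u eq)) (trans (cong class step-G-1s) class-1s)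
    class-step u 2F eq = let u≢0 , u≢1 = class≡2⇒ u eq in
      class-other (u≢0 ∘ step-G≡0s u) (u≢1 ∘ step-G≡1s u)

    class-cong : ∀ {u v} → EqClosure Remaining u v → class u ≡ class v
    class-cong = Eq.gfold isEquivalence class λ {u} u→v →
      trans (sym (class-step u _ refl)) (cong class (sym (remaining⇒step u→v)))

    -- The successor of 0...0 in the register of 1 + `L`, where the long orbit resumes once 0...0 is
    -- cut out.
    base : Vec Parity (suc ℓ)
    base = 0s ℓ ∷ʳ 1ℙ

    -- Complementation carries the register with feedback L to the one with
    -- feedback 1 + L, which agrees with step G except on 0…0 and 10…0; so the
    -- single nonzero orbit of L becomes a path of remaining edges from base.
    Reached : Vec Parity (suc ℓ) → Set
    Reached t = t ≡ 0s (suc ℓ) ⊎ EqClosure Remaining base t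

    reached-edge : ∀ {b ρ} → ρ ≢ 0s ℓ → Reached (b ∷ ρ) → Reached (step (_⁻¹ ∘ L) (b ∷ ρ))
    reached-edge ρ≢0 (inj₁ refl) = contradiction refl ρ≢0
    reached-edge {b} {ρ} ρ≢0 (inj₂ base~t) = inj₂ (subst (EqClosure Remaining base)
      (cong (λ y → ρ ∷ʳ y ⁻¹) (F-≢0s b ρ≢0)) (base~t ◅◅ fwd (step⇒remaining (b ∷ ρ)) ◅ ε))

    reached-step : ∀ {t} → Reached t → Reached (step (_⁻¹ ∘ L) t)
    reached-step {0ℙ ∷ ρ} reached with ρ ≟ 0s ℓ
    -- From 0...0 the register of 1 + `L` moves to `base`, where the path starts.
    ... | yes refl = inj₂ (subst (EqClosure Remaining base)
                       (cong (λ y → 0s ℓ ∷ʳ y ⁻¹) (sym L-0s)) ε)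
    ... | no ρ≢0 = reached-edge ρ≢0 reached
    reached-step {1ℙ ∷ ρ} reached with ρ ≟ 0s ℓ
    -- The path ends at 10...0: the register of 1 + `L` continues to 0...0, while `step G` does not.
    ... | yes refl = inj₁ (trans (cong (λ y → 0s ℓ ∷ʳ y ⁻¹) L-unit) (replicate-∷ʳ ℓ 0ℙ))
    ... | no ρ≢0 = reached-edge ρ≢0 reached

    reached : ∀ {t} → t ≢ 1s (suc ℓ) → Reached t
    reached {t} t≢1 = subst Reached (complement-involutive t)
      (orbit-induction (Reached ∘ complement)
        (λ v reached → subst Reached (sym (step-complement L L-complement v)) (reached-step reached))
        -- The induction runs on complements along the orbit of `L`: starting at 1...1 means
        -- starting at 0...0 in the register of 1 + `L`, and the excluded 0...0 corresponds to
        -- 1...1.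
        {1s (suc ℓ)} (λ ()) (inj₁ (Vec.map-replicate _⁻¹ 1ℙ (suc ℓ)))
        λ ct≡0 → t≢1 (trans (sym (complement-involutive t))
          (trans (cong complement ct≡0) (Vec.map-replicate _⁻¹ 0ℙ (suc ℓ)))))

    connected : ∀ {t} → class t ≡ 2F → EqClosure Remaining base t
    connected {t} t∈ = go (reached (proj₂ (class≡2⇒ t t∈)))
      where
      go : Reached t → EqClosure Remaining base t
      go (inj₁ t≡0)    = contradiction t≡0 (proj₁ (class≡2⇒ t t∈))
      go (inj₂ base~t) = base~t

    class-injective : ∀ {u v} → class u ≡ class v → EqClosure Remaining u v
    class-injective {u} {v} eq = go (class v) eq refl
      where
      go : ∀ k → class u ≡ k → class v ≡ k → EqClosure Remaining u v
      go 0F u∈ v∈ = subst (EqClosure Remaining u) (trans (class≡0⇒ u u∈) (sym (class≡0⇒ v v∈))) ε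
      go 1F u∈ v∈ = subst (EqClosure Remaining u) (trans (class≡1⇒ u u∈) (sym (class≡1⇒ v v∈))) ε
      go 2F u∈ v∈ = Eq.symmetric Remaining (connected u∈) ◅◅ connected v∈

    class-surjective : ∀ k → ∃ λ u → class u ≡ k
    class-surjective 0F = 0s (suc ℓ) , class-0s
    class-surjective 1F = 1s (suc ℓ) , class-1s
    -- As `ℓ` is positive, 10...0 differs from 1...1.
    class-surjective 2F = 1ℙ ∷ 0s ℓ , class-other {1ℙ ∷ 0s ℓ} (λ ()) (λ ())

    doubleHelix : DoubleHelix (suc ℓ) X
    doubleHelix = record
      { deBruijn        = deBruijnString
      ; threeComponents = record
        { to        = class
        ; cong      = class-cong
        ; bijective = class-injective
                    , λ k → let u , u∈k = class-surjective k in u , λ v~u → trans (class-cong v~u) u∈k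
        }
      ; loopAtZeros     = subst (Remaining _) step-G-0s (step⇒remaining _)
                        , λ w 0~w → class≡0⇒ w (trans (sym (class-cong 0~w)) class-0s)
      ; loopAtOnes      = subst (Remaining _) step-G-1s (step⇒remaining _)
                        , λ w 1~w → class≡1⇒ w (trans (sym (class-cong 1~w)) class-1s)
      }

-- Reduction to a stretch of the unrolled cycle

theorem4p2 : (n : ℕ) → 2 ≤ n → (X : List Parity) → LinearDeBruijnSequence n X → DoubleHelix n X
theorem4p2 (suc zero) (s≤s ())
theorem4p2 (suc (suc m)) _ X (Z , cycle , Y , Z~Y , X≡)
  = subst (DoubleHelix (suc (suc m))) (sym X≡reading) (Cycle.doubleHelix shifted zeros-first (proj₁ Y-reading))
  where
  open LinearDeBruijnCycle cycle
  N ℓ : ℕ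
  N = 2 ^ suc (suc m) ∸ 1
  ℓ = suc m

  W-reading : ∃ λ r → W ≡ applyUpTo (λ k → a (r + k)) N
  W-reading = rotation-applyUpTo (PN.a-periodic isPN) rotation

  -- The PN sequence restarted at its run of zeros, so that the extra 0 goes in front of index 0.
  b : ℕ → Parity
  b k = a (proj₁ W-reading + k)

  shifted : PNSequence (suc (suc m)) b
  shifted = PNSequence-shift isPN (proj₁ W-reading)

  ℓ≤N : ℓ ≤ N
  ℓ≤N = PN.ℓ≤N isPN

  zeros-first : ∀ j → j < ℓ → b j ≡ 0ℙ
  zeros-first = applyUpTo-injective ℓ (begin
    applyUpTo b ℓ             ≡⟨ take-applyUpTo b ℓ≤N ⟨
    take ℓ (applyUpTo b N)    ≡⟨ cong (take ℓ) (proj₂ W-reading) ⟨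
    take ℓ W                  ≡⟨ zeros ⟩
    replicate ℓ 0ℙ            ≡⟨ applyUpTo-const 0ℙ ℓ ⟨
    applyUpTo (λ _ → 0ℙ) ℓ    ∎)
    where open ≡-Reasoning

  open Cycle shifted zeros-first using (z; z-periodic; z≡0∷a; 0∷a)

  Z-reading : Z ≡ applyUpTo z (suc N)
  Z-reading = trans inserted (trans (cong (0ℙ ∷_) (proj₂ W-reading))
    (applyUpTo-cong {f = 0∷a} (suc N) λ k k<P → sym (z≡0∷a (≤-trans k<P (m≤m+n (suc N) ℓ)))))

  Y-reading : ∃ λ r → Y ≡ applyUpTo (λ k → z (r + k)) (suc N)
  Y-reading = rotation-applyUpTo z-periodic (subst (λ U → Rotation U Y) Z-reading Z~Y)

  x : ℕ → Parity
  x k = z (proj₁ Y-reading + k)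

  X≡reading : X ≡ applyUpTo x (suc N + ℓ)
  X≡reading = begin
    X                                                    ≡⟨ X≡ ⟩
    Y ++ take ℓ Y                                        ≡⟨ cong (λ U → U ++ take ℓ U) (proj₂ Y-reading) ⟩
    applyUpTo x (suc N) ++ take ℓ (applyUpTo x (suc N))  ≡⟨ cong (applyUpTo x (suc N) ++_) wrap ⟩
    applyUpTo x (suc N) ++ applyUpTo (λ k → x (suc N + k)) ℓ  ≡⟨ applyUpTo-+ x (suc N) ℓ ⟨
    applyUpTo x (suc N + ℓ)                              ∎
    where
    open ≡-Reasoning
    wrap : take ℓ (applyUpTo x (suc N)) ≡ applyUpTo (λ k → x (suc N + k)) ℓ
    -- As `ℓ` is at most a full lap, the appended digits are the first `ℓ` digits, which by
    -- periodicity continue the reading.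
    wrap = trans (take-applyUpTo x (m≤n⇒m≤1+n ℓ≤N)) (applyUpTo-cong ℓ λ k _ → sym
      (trans (cong x (+-comm (suc N) k)) (periodic-shift z-periodic (proj₁ Y-reading) k)))
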